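{- Let $\mathcal B$ be a DDSA and $\chi$ a $\mathrm{CTL}^*_f$ state formula such that $\mathit{checkState}(\chi)$ is defined. Then for every configuration $(b,\alpha)$ of $\mathcal B$, $(b,\alpha)\models\chi$ if and only if $\alpha\models\mathit{checkState}(\chi)(b)$.
   Context: DDSA: Variables $V$ are sorted (domains $\mathbb Z,\mathbb Q,\mathbb R$); constraints are quantifier-free Boolean combinations of linear (in)equalities and integer congruences; $\mathcal C(V)$ is the set of constraints over $V$. A DDSA is $\mathcal B=\langle B,b_I,\mathcal A,T,B_F,V,\alpha_I,\mathit{guard}\rangle$ with finite control states $B$, initial state $b_I$, actions $\mathcal A$, $T\subseteq B\times\mathcal A\times B$, final states $B_F$, initial assignment $\alpha_I$, $\mathit{guard}\colon\mathcal A\to\mathcal C(V^r\cup V^w)$ over read/write copies $v^r,v^w$ of $v\in V$; $\mathit{write}(a)=\{v\mid v^w\text{ occurs in }\mathit{guard}(a)\}$. A step $(b,\alpha)\xrightarrow{a}(b',\alpha')$ requires $(b,a,b')\in T$, $\alpha'(v)=\alpha(v)$ for $v\notin\mathit{write}(a)$, and $\beta\models\mathit{guard}(a)$ for $\beta(v^r)=\alpha(v),\beta(v^w)=\alpha'(v)$. A run of length $n\ge0$ is a sequence of steps $(b_0,\alpha_0)\xrightarrow{a_1}\dots\xrightarrow{a_n}(b_n,\alpha_n)$, $\rho_i=(b_i,\alpha_i)$; $\mathrm{FRuns}(b,\alpha)$ is the set of runs from $(b,\alpha)$ whose last state is in $B_F$. $\mathrm{CTL}^*_f$: state formulas $\chi::=\top\mid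 c\mid b\mid\chi\wedge\chi\mid\neg\chi\mid\mathsf E\psi$ ($c\in\mathcal C(V)$, $b\in B$), path formulas $\psi::=\chi\mid\psi\wedge\psi\mid\neg\psi\mid\mathsf X\psi\mid\mathsf G\psi\mid\psi\,\mathsf U\,\psi$. $(b,\alpha)\models\top$; $(b,\alpha)\models c$ iff $\alpha\models c$; $(b,\alpha)\models b'$ iff $b=b'$; Boolean connectives as usual; $(b,\alpha)\models\mathsf E\psi$ iff some $\rho\in\mathrm{FRuns}(b,\alpha)$ has $\rho,0\models\psi$. For a run of length $n$, $0\le i\le n$: $\rho,i\models\chi$ iff $\rho_i\models\chi$; $\rho,i\models\mathsf X\psi$ iff $i<n$ and $\rho,i+1\models\psi$; $\rho,i\models\mathsf G\psi$ iff $\rho,j\models\psi$ for all $i\le j\le n$; $\rho,i\models\psi\,\mathsf U\,\psi'$ iff there is $k$ with $i+k\le n$, $\rho,i+k\models\psi'$ and $\rho,i+j\models\psi$ for all $0\le j<k$. The quantifier depth $\mathrm{qd}$ is the maximal nesting of $\mathsf E$. Configuration maps and $\mathrm{LTL}_{\mathrm{conf}}$: a configuration map is $K\colon B\to\mathcal C(V)$; $K_\top=\lambda b.\top$, $K_{b'}(b)=\top$ if $b=b'$ and $\bot$ otherwise, $K_c=\lambda b.c$, $(\neg K)(b)=\neg K(b)$, $(K\wedge K')(b)=K(b)\wedge K'(b)$. $\mathrm{LTL}_{\mathrm{conf}}$ formulas are built from configuration maps with $\wedge,\neg,\mathsf X,\mathsf G,\mathsf U$; $\rho,i\models K$ iff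 $\rho_i=(b,\alpha)$ and $\alpha\models K(b)$; other operators as for path formulas above. Product automaton: for an $\mathrm{LTL}_{\mathrm{conf}}$ formula $\psi$ let $\mathcal N_\psi=(Q,2^{\mathcal K},\varrho,q_0,Q_F)$ be an NFA over sets of configuration maps such that for every run $\rho$, $\mathcal N_\psi$ accepts a word $w_0\cdots w_n$ with $\alpha_i\models\bigwedge_{K\in w_i}K(b_i)$ for all $i$ iff $\rho,0\models\psi$ (the paper constructs such an NFA in the standard way). Fix placeholder variables $V_0$ with bijection $\nu\colon V\to V_0$, $\phi_\nu=\bigwedge_v v=\nu(v)$, $\Delta_a=\mathit{guard}(a)\wedge\bigwedge_{v\notin\mathit{write}(a)}v^w=v^r$, $\mathit{update}(\phi,a)=\exists\vec U.\phi(\vec U)\wedge\Delta_a(\vec U,\vec V)$ (with $\phi(\vec U)$ replacing $\vec V$ by fresh $\vec U$, $V_0$ unchanged). $\mathcal B_b$ is $\mathcal B$ with fresh initial dummy state $\hat b$ and transition $(\hat b,a_0,b)$, $\mathit{guard}(a_0)=\top$. $\mathcal N^\psi_{\mathcal B,b}$ has initial state $(\hat b,q_0,\phi_\nu)$ and transitions $(b',q,\varphi)\xrightarrow{a,w}(b'',q',\varphi')$ whenever $b'\xrightarrow{a}b''$ in $\mathcal B_b$, $(q,w,q')\in\varrho$, $\mathit{update}(\varphi,a)\wedge\bigwedge_{K\in w}K(b'')$ is satisfiable, and $\varphi'$ is equivalent to it (states identified up to logical equivalence); $(b'',q',\varphi')$ is final iff $b''\in B_F$, $q'\in Q_F$.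 Procedures: $\mathit{checkState}(\chi)$ returns $K_\chi$ for $\chi\in\{\top\}\cup B\cup\mathcal C(V)$, $\mathit{checkState}(\chi_1)\wedge\mathit{checkState}(\chi_2)$ for $\chi_1\wedge\chi_2$, $\neg\mathit{checkState}(\chi')$ for $\neg\chi'$, and $\mathit{checkPath}(\psi)$ for $\mathsf E\psi$. $\mathit{toLTL}(\psi)$ replaces $\top,b,c$ by $K_\top,K_b,K_c$, each subformula $\mathsf E\eta$ by $\mathit{checkPath}(\eta)$, and commutes with $\wedge,\neg,\mathsf X,\mathsf G,\mathsf U$. $\mathit{checkPath}(\psi)$: let $\psi'=\mathit{toLTL}(\psi)$; for each $b\in B$ build $\mathcal N^{\psi'}_{\mathcal B,b}$, let $\Phi$ be the set of formulas $\phi$ of its final states, and set $K(b)=\bigvee_{\phi\in\Phi}\exists\vec U.\phi(\vec V,\vec U)$, where $\phi(\vec V,\vec U)$ is $\phi$ with $\nu(v)$ replaced by $v$ and $v$ replaced by a fresh $u_v$; return $K$. $\mathit{checkState}(\chi)$ is defined if all product automata built during this recursive computation are finite. -}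

module Defs where

open import Algebra.Bundles using (AbelianGroup)
open import Algebra.Properties.AbelianGroup using (xyx⁻¹≈y)
open import Algebra.Properties.CommutativeSemigroup using (interchange)
open import Data.Nat as ℕ using (ℕ; zero; suc)
import Data.Nat.Properties as ℕ
open import Data.Integer as ℤ using (ℤ)
import Data.Integer.Divisibility as ℤ
open import Data.Rational as ℚ using (ℚ; 0ℚ; 1ℚ; ½)
import Data.Rational.Properties as ℚ
open import Data.Fin using (Fin; zero; suc; toℕ; _≟_)
open import Data.Fin.Subset using (Subset; outside) renaming (_∈_ to _∈ₛ_)
open import Data.Fin.Subset.Properties using () renaming (_∈?_ to _∈ₛ?_)
open import Data.List using (List; []; _∷_; _++_; map; foldr; filter; allFin)
open import Data.List.Relation.Unary.All using (All)
open import Data.List.Relation.Unary.Any using (Any)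
open import Data.Maybe using (Maybe; just; nothing)
open import Data.Product using (Σ; ∃; _×_; _,_; proj₁; proj₂)
open import Data.Sum using (_⊎_; inj₁; inj₂)
open import Data.Sum.Properties using (≡-dec)
open import Data.Unit using (⊤)
open import Data.Vec as Vec using (Vec)
open import Function.Bundles using (_⇔_)
open import Relation.Binary.Construct.Closure.ReflexiveTransitive using (Star)
open import Relation.Binary.PropositionalEquality
  using (_≡_; refl; sym; trans; cong; cong₂; subst)
open import Relation.Nullary using (¬_; yes; no)
open import Relation.Nullary.Decidable using (¬?)
import Data.List.Membership.DecPropositional as DecMembership

-- Reals are rational Cauchy sequences, with setoid equality _≈ℝ_.

IsCauchy : (ℕ → ℚ) → Set
IsCauchy x = ∀ ε → 0ℚ ℚ.< ε → ∃ λ N → ∀ m n → N ℕ.≤ m → N ℕ.≤ n →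
  ℚ.∣ x m ℚ.- x n ∣ ℚ.< ε

record ℝ : Set where
  constructor mkℝ
  field
    seq    : ℕ → ℚ
    cauchy : IsCauchy seq

open ℝ public

module Cauchy where
  +-rearrange : ∀ a b c d → (a ℚ.+ b) ℚ.- (c ℚ.+ d) ≡ (a ℚ.- c) ℚ.+ (b ℚ.- d)
  +-rearrange a b c d =
    trans (cong ((a ℚ.+ b) ℚ.+_) (ℚ.neg-distrib-+ c d))
          (interchange (AbelianGroup.commutativeSemigroup ℚ.+-0-abelianGroup) a b (ℚ.- c) (ℚ.- d))

  split : ∀ a b → a ≡ b ℚ.+ (a ℚ.- b)
  split a b = sym (trans (sym (ℚ.+-assoc b a (ℚ.- b))) (xyx⁻¹≈y ℚ.+-0-abelianGroup b a))

  telescope : ∀ p q r → p ℚ.- q ≡ (p ℚ.- r) ℚ.+ (r ℚ.- q)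
  telescope p q r = sym (trans (ℚ.+-assoc p (ℚ.- r) (r ℚ.- q)) (cong (p ℚ.+_)
    (trans (sym (ℚ.+-assoc (ℚ.- r) r (ℚ.- q)))
      (trans (cong (ℚ._- q) (ℚ.+-inverseˡ r)) (ℚ.+-identityˡ (ℚ.- q))))))

  *-distribˡ-- : ∀ a b d → a ℚ.* b ℚ.- a ℚ.* d ≡ a ℚ.* (b ℚ.- d)
  *-distribˡ-- a b d = sym (trans (ℚ.*-distribˡ-+ a b (ℚ.- d))
    (cong (a ℚ.* b ℚ.+_) (sym (ℚ.neg-distribʳ-* a d))))

  *-rearrange : ∀ a b c d → a ℚ.* b ℚ.- c ℚ.* d ≡ a ℚ.* (b ℚ.- d) ℚ.+ d ℚ.* (a ℚ.- c)
  *-rearrange a b c d = trans (telescope (a ℚ.* b) (c ℚ.* d) (a ℚ.* d))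
    (cong₂ ℚ._+_ (*-distribˡ-- a b d)
      (trans (cong₂ ℚ._-_ (ℚ.*-comm a d) (ℚ.*-comm c d)) (*-distribˡ-- d a c)))

  0<½* : ∀ {ε} → 0ℚ ℚ.< ε → 0ℚ ℚ.< ½ ℚ.* ε
  0<½* {ε} 0<ε = subst (ℚ._< ½ ℚ.* ε) (ℚ.*-zeroʳ ½) (ℚ.*-monoʳ-<-pos ½ 0<ε)

  ½+½ : ∀ ε → ½ ℚ.* ε ℚ.+ ½ ℚ.* ε ≡ ε
  ½+½ ε = trans (sym (ℚ.*-distribʳ-+ ε ½ ½)) (ℚ.*-identityˡ ε)

  +-cauchy : ∀ x y → IsCauchy x → IsCauchy y → IsCauchy (λ n → x n ℚ.+ y n)
  +-cauchy x y cx cy ε 0<ε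
    with cx (½ ℚ.* ε) (0<½* 0<ε) | cy (½ ℚ.* ε) (0<½* 0<ε)
  ... | N₁ , h₁ | N₂ , h₂ = N₁ ℕ.⊔ N₂ , λ m n N≤m N≤n → begin-strict
      ℚ.∣ (x m ℚ.+ y m) ℚ.- (x n ℚ.+ y n) ∣
        ≡⟨ cong ℚ.∣_∣ (+-rearrange (x m) (y m) (x n) (y n)) ⟩
      ℚ.∣ (x m ℚ.- x n) ℚ.+ (y m ℚ.- y n) ∣
        ≤⟨ ℚ.∣p+q∣≤∣p∣+∣q∣ (x m ℚ.- x n) (y m ℚ.- y n) ⟩
      ℚ.∣ x m ℚ.- x n ∣ ℚ.+ ℚ.∣ y m ℚ.- y n ∣
        <⟨ ℚ.+-mono-< (h₁ m n (ℕ.m⊔n≤o⇒m≤o N₁ N₂ N≤m) (ℕ.m⊔n≤o⇒m≤o N₁ N₂ N≤n))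
                      (h₂ m n (ℕ.m⊔n≤o⇒n≤o N₁ N₂ N≤m) (ℕ.m⊔n≤o⇒n≤o N₁ N₂ N≤n)) ⟩
      ½ ℚ.* ε ℚ.+ ½ ℚ.* ε
        ≡⟨ ½+½ ε ⟩
      ε ∎
    where
    open ℚ.≤-Reasoning

  0<1 : 0ℚ ℚ.< 1ℚ
  0<1 = ℚ.positive⁻¹ 1ℚ

  bounded : ∀ x → IsCauchy x →
    ∃ λ M → 0ℚ ℚ.< M × ∃ λ N → ∀ n → N ℕ.≤ n → ℚ.∣ x n ∣ ℚ.≤ M
  bounded x cx with cx 1ℚ 0<1
  ... | N , h = ℚ.∣ x N ∣ ℚ.+ 1ℚ
              , ℚ.+-mono-≤-< (ℚ.0≤∣p∣ (x N)) 0<1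
              , N , λ n N≤n → begin
      ℚ.∣ x n ∣
        ≡⟨ cong ℚ.∣_∣ (split (x n) (x N)) ⟩
      ℚ.∣ x N ℚ.+ (x n ℚ.- x N) ∣
        ≤⟨ ℚ.∣p+q∣≤∣p∣+∣q∣ (x N) (x n ℚ.- x N) ⟩
      ℚ.∣ x N ∣ ℚ.+ ℚ.∣ x n ℚ.- x N ∣
        ≤⟨ ℚ.+-monoʳ-≤ ℚ.∣ x N ∣ (ℚ.<⇒≤ (h n N N≤n ℕ.≤-refl)) ⟩
      ℚ.∣ x N ∣ ℚ.+ 1ℚ ∎
    where
    open ℚ.≤-Reasoning

  *-cauchy : ∀ x y → IsCauchy x → IsCauchy y → IsCauchy (λ n → x n ℚ.* y n)
  *-cauchy x y cx cy ε 0<ε with bounded x cx | bounded y cy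
  ... | A , 0<A , N₁ , bx | B , 0<B , N₂ , by = N , λ m n N≤m N≤n → begin-strict
      ℚ.∣ x m ℚ.* y m ℚ.- x n ℚ.* y n ∣
        ≡⟨ cong ℚ.∣_∣ (*-rearrange (x m) (y m) (x n) (y n)) ⟩
      ℚ.∣ x m ℚ.* (y m ℚ.- y n) ℚ.+ y n ℚ.* (x m ℚ.- x n) ∣
        ≤⟨ ℚ.∣p+q∣≤∣p∣+∣q∣ (x m ℚ.* (y m ℚ.- y n)) (y n ℚ.* (x m ℚ.- x n)) ⟩
      ℚ.∣ x m ℚ.* (y m ℚ.- y n) ∣ ℚ.+ ℚ.∣ y n ℚ.* (x m ℚ.- x n) ∣
        ≡⟨ cong₂ ℚ._+_ (ℚ.∣p*q∣≡∣p∣*∣q∣ (x m) (y m ℚ.- y n))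
                       (ℚ.∣p*q∣≡∣p∣*∣q∣ (y n) (x m ℚ.- x n)) ⟩
      ℚ.∣ x m ∣ ℚ.* ℚ.∣ y m ℚ.- y n ∣ ℚ.+ ℚ.∣ y n ∣ ℚ.* ℚ.∣ x m ℚ.- x n ∣
        ≤⟨ ℚ.+-mono-≤
             (ℚ.*-monoʳ-≤-nonNeg ℚ.∣ y m ℚ.- y n ∣ {{abs-nonNeg (y m ℚ.- y n)}}
               (bx m (ℕ.≤-trans N₁≤N N≤m)))
             (ℚ.*-monoʳ-≤-nonNeg ℚ.∣ x m ℚ.- x n ∣ {{abs-nonNeg (x m ℚ.- x n)}}
               (by n (ℕ.≤-trans N₂≤N N≤n))) ⟩
      A ℚ.* ℚ.∣ y m ℚ.- y n ∣ ℚ.+ B ℚ.* ℚ.∣ x m ℚ.- x n ∣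
        <⟨ ℚ.+-mono-<
             (ℚ.*-monoʳ-<-pos A {{ℚ.positive 0<A}}
               (proj₂ cy′ m n (ℕ.≤-trans N₄≤N N≤m) (ℕ.≤-trans N₄≤N N≤n)))
             (ℚ.*-monoʳ-<-pos B {{ℚ.positive 0<B}}
               (proj₂ cx′ m n (ℕ.≤-trans N₃≤N N≤m) (ℕ.≤-trans N₃≤N N≤n))) ⟩
      A ℚ.* δ ℚ.+ B ℚ.* δ
        ≡⟨ sym (ℚ.*-distribʳ-+ δ A B) ⟩
      C ℚ.* δ
        ≡⟨ sym (ℚ.*-assoc C (ℚ.1/ C) ε) ⟩
      C ℚ.* ℚ.1/ C ℚ.* ε
        ≡⟨ cong (ℚ._* ε) (ℚ.*-inverseʳ C) ⟩
      1ℚ ℚ.* ε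
        ≡⟨ ℚ.*-identityˡ ε ⟩
      ε ∎
    where
    open ℚ.≤-Reasoning
    C = A ℚ.+ B
    instance
      C-pos : ℚ.Positive C
      C-pos = ℚ.positive (ℚ.+-mono-< 0<A 0<B)
      C-nonZero : ℚ.NonZero C
      C-nonZero = ℚ.pos⇒nonZero C
    δ = ℚ.1/ C ℚ.* ε
    0<δ : 0ℚ ℚ.< δ
    0<δ = subst (ℚ._< δ) (ℚ.*-zeroʳ (ℚ.1/ C))
            (ℚ.*-monoʳ-<-pos (ℚ.1/ C) {{ℚ.1/pos⇒pos C}} 0<ε)
    cx′ = cx δ 0<δ
    cy′ = cy δ 0<δ
    N₃ = proj₁ cx′
    N₄ = proj₁ cy′
    N = (N₁ ℕ.⊔ N₂) ℕ.⊔ (N₃ ℕ.⊔ N₄)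
    N₁≤N : N₁ ℕ.≤ N
    N₁≤N = ℕ.≤-trans (ℕ.m≤m⊔n N₁ N₂) (ℕ.m≤m⊔n (N₁ ℕ.⊔ N₂) (N₃ ℕ.⊔ N₄))
    N₂≤N : N₂ ℕ.≤ N
    N₂≤N = ℕ.≤-trans (ℕ.m≤n⊔m N₁ N₂) (ℕ.m≤m⊔n (N₁ ℕ.⊔ N₂) (N₃ ℕ.⊔ N₄))
    N₃≤N : N₃ ℕ.≤ N
    N₃≤N = ℕ.≤-trans (ℕ.m≤m⊔n N₃ N₄) (ℕ.m≤n⊔m (N₁ ℕ.⊔ N₂) (N₃ ℕ.⊔ N₄))
    N₄≤N : N₄ ℕ.≤ N
    N₄≤N = ℕ.≤-trans (ℕ.m≤n⊔m N₃ N₄) (ℕ.m≤n⊔m (N₁ ℕ.⊔ N₂) (N₃ ℕ.⊔ N₄))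
    abs-nonNeg : ∀ p → ℚ.NonNegative ℚ.∣ p ∣
    abs-nonNeg p = ℚ.nonNegative (ℚ.0≤∣p∣ p)

open Cauchy using (+-cauchy; *-cauchy)

infixl 6 _+ℝ_
infixl 7 _*ℝ_
infix  4 _≈ℝ_ _<ℝ_ _≤ℝ_

_+ℝ_ _*ℝ_ : ℝ → ℝ → ℝ
x +ℝ y = mkℝ (λ n → seq x n ℚ.+ seq y n) (+-cauchy (seq x) (seq y) (cauchy x) (cauchy y))
x *ℝ y = mkℝ (λ n → seq x n ℚ.* seq y n) (*-cauchy (seq x) (seq y) (cauchy x) (cauchy y))

_≈ℝ_ _<ℝ_ _≤ℝ_ : ℝ → ℝ → Set
x ≈ℝ y = ∀ ε → 0ℚ ℚ.< ε → ∃ λ N → ∀ n → N ℕ.≤ n → ℚ.∣ seq x n ℚ.- seq y n ∣ ℚ.< ε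
x <ℝ y = ∃ λ ε → 0ℚ ℚ.< ε × ∃ λ N → ∀ n → N ℕ.≤ n → seq x n ℚ.+ ε ℚ.< seq y n
x ≤ℝ y = ∀ ε → 0ℚ ℚ.< ε → ∃ λ N → ∀ n → N ℕ.≤ n → seq x n ℚ.< seq y n ℚ.+ ε

data Sort : Set where
  int rat real : Sort

⟦_⟧ : Sort → Set
⟦ int ⟧  = ℤ
⟦ rat ⟧  = ℚ
⟦ real ⟧ = ℝ

add mul : ∀ {s} → ⟦ s ⟧ → ⟦ s ⟧ → ⟦ s ⟧
add {int}  = ℤ._+_
add {rat}  = ℚ._+_
add {real} = _+ℝ_
mul {int}  = ℤ._*_
mul {rat}  = ℚ._*_
mul {real} = _*ℝ_

Eq Lt Le : ∀ {s} → ⟦ s ⟧ → ⟦ s ⟧ → Set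
Eq {int}  = _≡_
Eq {rat}  = _≡_
Eq {real} = _≈ℝ_
Lt {int}  = ℤ._<_
Lt {rat}  = ℚ._<_
Lt {real} = _<ℝ_
Le {int}  = ℤ._≤_
Le {rat}  = ℚ._≤_
Le {real} = _≤ℝ_

Assignment : {X : Set} → (X → Sort) → Set
Assignment σ = ∀ x → ⟦ σ x ⟧

infixl 5 _⊞_ _▹_

_⊞_ : {X Y : Set} → (X → Sort) → (Y → Sort) → (X ⊎ Y → Sort)
(σ ⊞ τ) (inj₁ x) = σ x
(σ ⊞ τ) (inj₂ y) = τ y

_▹_ : ∀ {X Y} {σ : X → Sort} {τ : Y → Sort} →
      Assignment σ → Assignment τ → Assignment (σ ⊞ τ)
(α ▹ β) (inj₁ x) = α x
(α ▹ β) (inj₂ y) = β y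

infixl 6 _⊕_
infixl 7 _⊙_

data Term {X : Set} (σ : X → Sort) : Sort → Set where
  var   : ∀ x → Term σ (σ x)
  const : ∀ {s} → ⟦ s ⟧ → Term σ s
  _⊕_   : ∀ {s} → Term σ s → Term σ s → Term σ s
  _⊙_   : ∀ {s} → ⟦ s ⟧ → Term σ s → Term σ s

data Constraint {X : Set} (σ : X → Sort) : Set where
  true        : Constraint σ
  eq lt le    : ∀ {s} → Term σ s → Term σ s → Constraint σ
  congruent   : (m : ℕ) → Term σ int → Term σ int → Constraint σ
  and or      : Constraint σ → Constraint σ → Constraint σ
  not         : Constraint σ → Constraint σ

-- The variables τ of a quantifier block are appended to the free variables σ.
data Formula {X : Set} (σ : X → Sort) : Set where
  ⌜_⌝    : Constraint σ → Formula σ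
  and or : Formula σ → Formula σ → Formula σ
  not    : Formula σ → Formula σ
  exists : ∀ {m} (τ : Fin m → Sort) → Formula (σ ⊞ τ) → Formula σ

module _ {X : Set} {σ : X → Sort} where

  ⟦_⟧ᵗ : ∀ {s} → Term σ s → Assignment σ → ⟦ s ⟧
  ⟦ var x ⟧ᵗ   α = α x
  ⟦ const k ⟧ᵗ α = k
  ⟦ t ⊕ u ⟧ᵗ   α = add (⟦ t ⟧ᵗ α) (⟦ u ⟧ᵗ α)
  ⟦ k ⊙ t ⟧ᵗ   α = mul k (⟦ t ⟧ᵗ α)

  infix 3 _⊨ᶜ_

  _⊨ᶜ_ : Assignment σ → Constraint σ → Set
  α ⊨ᶜ true            = ⊤
  α ⊨ᶜ eq t u          = Eq (⟦ t ⟧ᵗ α) (⟦ u ⟧ᵗ α)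
  α ⊨ᶜ lt t u          = Lt (⟦ t ⟧ᵗ α) (⟦ u ⟧ᵗ α)
  α ⊨ᶜ le t u          = Le (⟦ t ⟧ᵗ α) (⟦ u ⟧ᵗ α)
  α ⊨ᶜ congruent m t u = ℤ.+ m ℤ.∣ ⟦ t ⟧ᵗ α ℤ.- ⟦ u ⟧ᵗ α
  α ⊨ᶜ and c d         = (α ⊨ᶜ c) × (α ⊨ᶜ d)
  α ⊨ᶜ or c d          = (α ⊨ᶜ c) ⊎ (α ⊨ᶜ d)
  α ⊨ᶜ not c           = ¬ (α ⊨ᶜ c)

  varsᵗ : ∀ {s} → Term σ s → List X
  varsᵗ (var x)   = x ∷ []
  varsᵗ (const _) = []
  varsᵗ (t ⊕ u)   = varsᵗ t ++ varsᵗ u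
  varsᵗ (_ ⊙ t)   = varsᵗ t

  vars : Constraint σ → List X
  vars true              = []
  vars (eq t u)          = varsᵗ t ++ varsᵗ u
  vars (lt t u)          = varsᵗ t ++ varsᵗ u
  vars (le t u)          = varsᵗ t ++ varsᵗ u
  vars (congruent _ t u) = varsᵗ t ++ varsᵗ u
  vars (and c d)         = vars c ++ vars d
  vars (or c d)          = vars c ++ vars d
  vars (not c)           = vars c

  ⋀ : List (Constraint σ) → Constraint σ
  ⋀ = foldr and true

  ⋁ : List (Formula σ) → Formula σ
  ⋁ = foldr or ⌜ not true ⌝

infix 3 _⊨ᶠ_
infix 4 _≃_

_⊨ᶠ_ : ∀ {X} {σ : X → Sort} → Assignment σ → Formula σ → Set
α ⊨ᶠ ⌜ c ⌝      = α ⊨ᶜ c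
α ⊨ᶠ and φ θ    = (α ⊨ᶠ φ) × (α ⊨ᶠ θ)
α ⊨ᶠ or φ θ     = (α ⊨ᶠ φ) ⊎ (α ⊨ᶠ θ)
α ⊨ᶠ not φ      = ¬ (α ⊨ᶠ φ)
α ⊨ᶠ exists τ φ = ∃ λ (β : Assignment τ) → α ▹ β ⊨ᶠ φ

Satisfiable : ∀ {X} {σ : X → Sort} → Formula σ → Set
Satisfiable φ = ∃ λ α → α ⊨ᶠ φ

_≃_ : ∀ {X} {σ : X → Sort} → Formula σ → Formula σ → Set
φ ≃ θ = ∀ α → (α ⊨ᶠ φ) ⇔ (α ⊨ᶠ θ)

Substitution : {X Y : Set} → (X → Sort) → (Y → Sort) → Set
Substitution σ τ = ∀ x → Term τ (σ x)

substᵗ : ∀ {X Y} {σ : X → Sort} {τ : Y → Sort} →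
         Substitution σ τ → ∀ {s} → Term σ s → Term τ s
substᵗ f (var x)   = f x
substᵗ f (const k) = const k
substᵗ f (t ⊕ u)   = substᵗ f t ⊕ substᵗ f u
substᵗ f (k ⊙ t)   = k ⊙ substᵗ f t

substᶜ : ∀ {X Y} {σ : X → Sort} {τ : Y → Sort} →
         Substitution σ τ → Constraint σ → Constraint τ
substᶜ f true              = true
substᶜ f (eq t u)          = eq (substᵗ f t) (substᵗ f u)
substᶜ f (lt t u)          = lt (substᵗ f t) (substᵗ f u)
substᶜ f (le t u)          = le (substᵗ f t) (substᵗ f u)
substᶜ f (congruent m t u) = congruent m (substᵗ f t) (substᵗ f u)
substᶜ f (and c d)         = and (substᶜ f c) (substᶜ f d)
substᶜ f (or c d)          = or (substᶜ f c) (substᶜ f d)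
substᶜ f (not c)           = not (substᶜ f c)

lift : ∀ {X Y Z} {σ : X → Sort} {τ : Y → Sort} (υ : Z → Sort) →
       Substitution σ τ → Substitution (σ ⊞ υ) (τ ⊞ υ)
lift υ f (inj₁ x) = substᵗ (λ y → var (inj₁ y)) (f x)
lift υ f (inj₂ z) = var (inj₂ z)

substᶠ : ∀ {X Y} {σ : X → Sort} {τ : Y → Sort} →
         Substitution σ τ → Formula σ → Formula τ
substᶠ f ⌜ c ⌝        = ⌜ substᶜ f c ⌝
substᶠ f (and φ θ)    = and (substᶠ f φ) (substᶠ f θ)
substᶠ f (or φ θ)     = or (substᶠ f φ) (substᶠ f θ)
substᶠ f (not φ)      = not (substᶠ f φ)
substᶠ f (exists υ φ) = exists υ (substᶠ (lift υ f) φ)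

-- The variables are Fin n with sorts σ.  In guards, inj₁ v is the read copy and inj₂ v the write copy of v.
record DDSA {n : ℕ} (σ : Fin n → Sort) : Set₁ where
  field
    size   : ℕ
  State : Set
  State = Fin size
  field
    init   : State
    Action : Set
    Trans  : State → Action → State → Set
    final  : Subset size
    α-init : Assignment σ
    guard  : Action → Constraint (σ ⊞ σ)

module _ {n : ℕ} {σ : Fin n → Sort} (𝓑 : DDSA σ) where
  open DDSA 𝓑
  open DecMembership (≡-dec (_≟_ {n}) (_≟_ {n})) using (_∈_; _∈?_)

  Written : Action → Fin n → Set
  Written a v = inj₂ v ∈ vars (guard a)

  Configuration : Set
  Configuration = State × Assignment σ

  data Step : Configuration → Action → Configuration → Set where
    step : ∀ {b α a b′ α′} →
           Trans b a b′ →
           (∀ v → ¬ Written a v → Eq (α′ v) (α v)) →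
           α ▹ α′ ⊨ᶜ guard a →
           Step (b , α) a (b′ , α′)

  data Run : Configuration → Set where
    stop : ∀ γ → Run γ
    next : ∀ {γ a γ′} → Step γ a γ′ → Run γ′ → Run γ

  length : ∀ {γ} → Run γ → ℕ
  length (stop _)   = 0
  length (next _ ρ) = suc (length ρ)

  Position : ∀ {γ} → Run γ → Set
  Position ρ = Fin (suc (length ρ))

  at : ∀ {γ} (ρ : Run γ) → Position ρ → Configuration
  at {γ} _      zero    = γ
  at (next _ ρ) (suc i) = at ρ i

  last : ∀ {γ} → Run γ → Configuration
  last (stop γ)   = γ
  last (next _ ρ) = last ρ

  FRuns : Configuration → Set
  FRuns γ = Σ (Run γ) λ ρ → proj₁ (last ρ) ∈ₛ final

  infixr 7 _∧ˢ_ _∧ᵖ_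
  infixr 6 _U_

  mutual
    data StateFormula : Set where
      ⊤ˢ     : StateFormula
      constr : Constraint σ → StateFormula
      ctrl   : State → StateFormula
      _∧ˢ_   : StateFormula → StateFormula → StateFormula
      ¬ˢ_    : StateFormula → StateFormula
      E      : PathFormula → StateFormula

    data PathFormula : Set where
      state : StateFormula → PathFormula
      _∧ᵖ_  : PathFormula → PathFormula → PathFormula
      ¬ᵖ_   : PathFormula → PathFormula
      X G   : PathFormula → PathFormula
      _U_   : PathFormula → PathFormula → PathFormula

  infix 3 _⊨ˢ_ _⊨ᵖ_

  mutual
    _⊨ˢ_ : Configuration → StateFormula → Set
    γ       ⊨ˢ ⊤ˢ       = ⊤
    (b , α) ⊨ˢ constr c = α ⊨ᶜ c
    (b , α) ⊨ˢ ctrl b′  = b ≡ b′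
    γ       ⊨ˢ χ ∧ˢ χ′  = (γ ⊨ˢ χ) × (γ ⊨ˢ χ′)
    γ       ⊨ˢ ¬ˢ χ     = ¬ (γ ⊨ˢ χ)
    γ       ⊨ˢ E ψ      = Σ (FRuns γ) λ (ρ , _) → ρ , zero ⊨ᵖ ψ

    _⊨ᵖ_ : ∀ {γ} → Σ (Run γ) Position → PathFormula → Set
    ρ , i ⊨ᵖ state χ = at ρ i ⊨ˢ χ
    ρ , i ⊨ᵖ ψ ∧ᵖ ψ′ = (ρ , i ⊨ᵖ ψ) × (ρ , i ⊨ᵖ ψ′)
    ρ , i ⊨ᵖ ¬ᵖ ψ    = ¬ (ρ , i ⊨ᵖ ψ)
    ρ , i ⊨ᵖ X ψ     = Σ (Position ρ) λ j → toℕ j ≡ suc (toℕ i) × (ρ , j ⊨ᵖ ψ)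
    ρ , i ⊨ᵖ G ψ     = ∀ (j : Position ρ) → toℕ i ℕ.≤ toℕ j → ρ , j ⊨ᵖ ψ
    ρ , i ⊨ᵖ ψ U ψ′  = Σ (Position ρ) λ k → toℕ i ℕ.≤ toℕ k × (ρ , k ⊨ᵖ ψ′) ×
      (∀ (j : Position ρ) → toℕ i ℕ.≤ toℕ j → toℕ j ℕ.< toℕ k → ρ , j ⊨ᵖ ψ)

  ConfMap : Set
  ConfMap = State → Constraint σ

  infix 3 _⊨ᵏ_

  _⊨ᵏ_ : Configuration → ConfMap → Set
  (b , α) ⊨ᵏ K = α ⊨ᶜ K b

  K⊤ : ConfMap
  K⊤ _ = true

  Kctrl : State → ConfMap
  Kctrl b′ b with b ≟ b′
  ... | yes _ = true
  ... | no  _ = not true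

  Kconstr : Constraint σ → ConfMap
  Kconstr c _ = c

  ¬ᵏ_ : ConfMap → ConfMap
  (¬ᵏ K) b = not (K b)

  _∧ᵏ_ : ConfMap → ConfMap → ConfMap
  (K ∧ᵏ K′) b = and (K b) (K′ b)

  data LTL : Set where
    conf : ConfMap → LTL
    _∧ˡ_ : LTL → LTL → LTL
    ¬ˡ_  : LTL → LTL
    X G  : LTL → LTL
    _U_  : LTL → LTL → LTL

  infix 3 _⊨ˡ_

  _⊨ˡ_ : ∀ {γ} → Σ (Run γ) Position → LTL → Set
  ρ , i ⊨ˡ conf K  = at ρ i ⊨ᵏ K
  ρ , i ⊨ˡ ψ ∧ˡ ψ′ = (ρ , i ⊨ˡ ψ) × (ρ , i ⊨ˡ ψ′)
  ρ , i ⊨ˡ ¬ˡ ψ    = ¬ (ρ , i ⊨ˡ ψ)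
  ρ , i ⊨ˡ X ψ     = Σ (Position ρ) λ j → toℕ j ≡ suc (toℕ i) × (ρ , j ⊨ˡ ψ)
  ρ , i ⊨ˡ G ψ     = ∀ (j : Position ρ) → toℕ i ℕ.≤ toℕ j → ρ , j ⊨ˡ ψ
  ρ , i ⊨ˡ ψ U ψ′  = Σ (Position ρ) λ k → toℕ i ℕ.≤ toℕ k × (ρ , k ⊨ˡ ψ′) ×
    (∀ (j : Position ρ) → toℕ i ℕ.≤ toℕ j → toℕ j ℕ.< toℕ k → ρ , j ⊨ˡ ψ)

  -- The alphabet is the power set of the finite family 𝒦.
  record NFA : Set where
    field
      states maps : ℕ
      𝒦           : Fin maps → ConfMap
      ϱ           : Fin states → Subset maps → Subset states
      q₀          : Fin states
      accepting   : Subset states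

    Letter : Set
    Letter = Subset maps

    ⋀𝒦 : Letter → ConfMap
    ⋀𝒦 w b = ⋀ (map (λ K → 𝒦 K b) (filter (_∈ₛ? w) (allFin maps)))

    AcceptsFrom : Fin states → List Letter → Set
    AcceptsFrom q []      = q ∈ₛ accepting
    AcceptsFrom q (w ∷ u) = ∃ λ q′ → q′ ∈ₛ ϱ q w × AcceptsFrom q′ u

    Accepts : List Letter → Set
    Accepts = AcceptsFrom q₀

  Recognises : NFA → LTL → Set
  Recognises N ψ = ∀ {γ} (ρ : Run γ) →
    (∃ λ (w : Vec Letter (suc (length ρ))) →
       Accepts (Vec.toList w) × (∀ i → at ρ i ⊨ᵏ ⋀𝒦 (Vec.lookup w i)))
    ⇔ (ρ , zero ⊨ˡ ψ)
    where open NFA N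

  -- State formulas have free variables V₀ ⊎ V, with placeholder ν(v) = inj₁ v.
  φν : Formula (σ ⊞ σ)
  φν = ⌜ ⋀ (map (λ v → eq (var (inj₂ v)) (var (inj₁ v))) (allFin n)) ⌝

  Δ : Action → Constraint (σ ⊞ σ)
  Δ a = and (guard a)
    (⋀ (map (λ v → eq (var (inj₂ v)) (var (inj₁ v)))
            (filter (λ v → ¬? (inj₂ v ∈? vars (guard a))) (allFin n))))

  -- Inside the quantifier, the free variables are (V₀ ⊎ V) ⊎ U.
  update : Formula (σ ⊞ σ) → Action → Formula (σ ⊞ σ)
  update φ a = exists σ (and (substᶠ φ[U] φ) ⌜ substᶜ Δ[U,V] (Δ a) ⌝)
    where
    φ[U] : Substitution (σ ⊞ σ) ((σ ⊞ σ) ⊞ σ)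
    φ[U] (inj₁ v) = var (inj₁ (inj₁ v))
    φ[U] (inj₂ v) = var (inj₂ v)
    Δ[U,V] : Substitution (σ ⊞ σ) ((σ ⊞ σ) ⊞ σ)
    Δ[U,V] (inj₁ v) = var (inj₂ v)
    Δ[U,V] (inj₂ v) = var (inj₁ (inj₂ v))

  -- ∃U. φ(V,U): placeholders become V, and V becomes the bound block U.
  project : Formula (σ ⊞ σ) → Formula σ
  project φ = exists σ (substᶠ φ[V,U] φ)
    where
    φ[V,U] : Substitution (σ ⊞ σ) (σ ⊞ σ)
    φ[V,U] (inj₁ v) = var (inj₁ v)
    φ[V,U] (inj₂ v) = var (inj₂ v)

-- 𝓑_b: the dummy state b̂ is zero, the dummy action a₀ is nothing.
module _ {n : ℕ} {σ : Fin n → Sort} (𝓑 : DDSA σ) where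
  open DDSA 𝓑

  data DummyTrans (b : State) : Fin (suc size) → Maybe Action → Fin (suc size) → Set where
    start : DummyTrans b zero nothing (suc b)
    old   : ∀ {b₁ a b₂} → Trans b₁ a b₂ → DummyTrans b (suc b₁) (just a) (suc b₂)

  withDummy : State → DDSA σ
  withDummy b = record
    { size   = suc size
    ; init   = zero
    ; Action = Maybe Action
    ; Trans  = DummyTrans b
    ; final  = outside Vec.∷ final
    ; α-init = α-init
    ; guard  = λ { nothing → true ; (just a) → guard a }
    }

module Product {n : ℕ} {σ : Fin n → Sort} (𝓑 : DDSA σ) (N : NFA 𝓑) (b : DDSA.State 𝓑) where
  open NFA N
  𝓑ᵇ : DDSA σ
  𝓑ᵇ = withDummy 𝓑 b
  open DDSA 𝓑ᵇ

  PState : Set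
  PState = State × Fin states × Formula (σ ⊞ σ)

  initial : PState
  initial = init , q₀ , φν 𝓑ᵇ

  -- update(φ,a) ∧ ⋀_{K∈w} K(b″), for a control state b″ of 𝓑 (all transitions
  -- of 𝓑_b lead to such states).
  successor : Formula (σ ⊞ σ) → Action → Letter → DDSA.State 𝓑 → Formula (σ ⊞ σ)
  successor φ a w b″ =
    and (update 𝓑ᵇ φ a) ⌜ substᶜ (λ v → var (inj₂ v)) (⋀𝒦 w b″) ⌝

  data _⟶_ : PState → PState → Set where
    move : ∀ {b′ q φ a w b″ q′ φ′} →
           Trans b′ a (suc b″) →
           q′ ∈ₛ ϱ q w →
           Satisfiable (successor φ a w b″) →
           φ′ ≃ successor φ a w b″ →
           (b′ , q , φ) ⟶ (suc b″ , q′ , φ′)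

  _≈ᴾ_ : PState → PState → Set
  (b₁ , q₁ , φ₁) ≈ᴾ (b₂ , q₂ , φ₂) = b₁ ≡ b₂ × q₁ ≡ q₂ × φ₁ ≃ φ₂

  Reachable : PState → Set
  Reachable = Star _⟶_ initial

  -- The automaton consists of the reachable states, up to logical equivalence.
  record Finite : Set where
    field
      pstates  : List PState
      sound    : All Reachable pstates
      complete : ∀ {s} → Reachable s → Any (s ≈ᴾ_) pstates

    -- The set Φ of formulas of final states.
    Φ : List (Formula (σ ⊞ σ))
    Φ = map (λ s → proj₂ (proj₂ s))
          (filter (λ s → proj₁ (proj₂ s) ∈ₛ? accepting)
            (filter (λ s → proj₁ s ∈ₛ? final) pstates))

module _ {n : ℕ} {σ : Fin n → Sort} (𝓑 : DDSA σ) where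
  open DDSA 𝓑

  -- An execution of checkPath whose product automata are all finite, for
  -- ψ = toLTL of the argument.  The fields nfa and result are choices which
  -- the procedure leaves open: ⋁_{φ∈Φ} ∃U. φ(V,U) is not quantifier-free, so
  -- result b stands for any constraint equivalent to it, as produced by
  -- quantifier elimination.
  record CheckPath (ψ : LTL 𝓑) : Set where
    field
      nfa        : NFA 𝓑
      recognises : Recognises 𝓑 nfa ψ
      finite     : ∀ b → Product.Finite 𝓑 nfa b
      result     : ConfMap 𝓑
      result-≃   : ∀ b → ⌜ result b ⌝ ≃ ⋁ (map (project 𝓑) (Product.Finite.Φ (finite b)))

  -- An element of Defined χ witnesses that all product automata built by
  -- checkState(χ) are finite, and records the choices made along the way.
  mutual
    Defined : StateFormula 𝓑 → Set
    Defined ⊤ˢ         = ⊤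
    Defined (constr c) = ⊤
    Defined (ctrl b)   = ⊤
    Defined (χ ∧ˢ χ′)  = Defined χ × Defined χ′
    Defined (¬ˢ χ)     = Defined χ
    Defined (E ψ)      = Σ (Definedᵖ ψ) λ d → CheckPath (toLTL ψ d)

    Definedᵖ : PathFormula 𝓑 → Set
    Definedᵖ (state χ) = Defined χ
    Definedᵖ (ψ ∧ᵖ ψ′) = Definedᵖ ψ × Definedᵖ ψ′
    Definedᵖ (¬ᵖ ψ)    = Definedᵖ ψ
    Definedᵖ (X ψ)     = Definedᵖ ψ
    Definedᵖ (G ψ)     = Definedᵖ ψ
    Definedᵖ (ψ U ψ′)  = Definedᵖ ψ × Definedᵖ ψ′

    toLTL : (ψ : PathFormula 𝓑) → Definedᵖ ψ → LTL 𝓑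
    toLTL (state χ) d        = toLTLˢ χ d
    toLTL (ψ ∧ᵖ ψ′) (d , d′) = toLTL ψ d ∧ˡ toLTL ψ′ d′
    toLTL (¬ᵖ ψ)    d        = ¬ˡ toLTL ψ d
    toLTL (X ψ)     d        = X (toLTL ψ d)
    toLTL (G ψ)     d        = G (toLTL ψ d)
    toLTL (ψ U ψ′)  (d , d′) = toLTL ψ d U toLTL ψ′ d′

    toLTLˢ : (χ : StateFormula 𝓑) → Defined χ → LTL 𝓑
    toLTLˢ ⊤ˢ         _        = conf (K⊤ 𝓑)
    toLTLˢ (constr c) _        = conf (Kconstr 𝓑 c)
    toLTLˢ (ctrl b)   _        = conf (Kctrl 𝓑 b)
    toLTLˢ (χ ∧ˢ χ′)  (d , d′) = toLTLˢ χ d ∧ˡ toLTLˢ χ′ d′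
    toLTLˢ (¬ˢ χ)     d        = ¬ˡ toLTLˢ χ d
    toLTLˢ (E ψ)      (_ , p)  = conf (CheckPath.result p)

  checkState : (χ : StateFormula 𝓑) → Defined χ → ConfMap 𝓑
  checkState ⊤ˢ         _        = K⊤ 𝓑
  checkState (constr c) _        = Kconstr 𝓑 c
  checkState (ctrl b)   _        = Kctrl 𝓑 b
  checkState (χ ∧ˢ χ′)  (d , d′) = _∧ᵏ_ 𝓑 (checkState χ d) (checkState χ′ d′)
  checkState (¬ˢ χ)     d        = ¬ᵏ_ 𝓑 (checkState χ d)
  checkState (E ψ)      (_ , p)  = CheckPath.result p

{-# OPTIONS --safe #-}
module Submission where

-- A path of the product automaton from (b̂, q₀, φ_ν) to a state with formula φ is a symbolic run:
-- by the semantics of update, an assignment α₀ ▹ β satisfies φ exactly if some run of 𝓑 from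
-- (b, α₀) to an assignment β takes the actions and matches the letters of the path.  Hence
-- ⋁ ∃U. φ(V,U) over the final states holds at α₀ exactly if some final run from (b, α₀) is
-- accepted by the NFA, i.e. satisfies ψ.  Real variables agree only up to _≈ℝ_ across a step, so
-- the reconstructed run starts at an assignment ≈ α₀ and its first configuration is then replaced by (b, α₀).

open import Algebra.Bundles using (AbelianGroup)
open import Algebra.Properties.Group using (//-rightDividesʳ)
open import Data.Nat as ℕ using (ℕ; zero; suc)
import Data.Nat.Properties as ℕ
import Data.Integer as ℤ
import Data.Integer.Divisibility as ℤ
open import Data.Rational as ℚ using (ℚ; 0ℚ; ½)
import Data.Rational.Properties as ℚ
open import Data.Fin using (Fin; zero; suc; _≟_)
open import Data.Fin.Subset using () renaming (_∈_ to _∈ₛ_)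
open import Data.Fin.Subset.Properties using (drop-there) renaming (_∈?_ to _∈ₛ?_)
open import Data.List using ([]; _∷_; map; filter; allFin)
open import Data.List.Membership.Propositional using (_∈_; find; lose)
open import Data.List.Membership.Propositional.Properties using
  (∈-allFin; ∈-filter⁺; ∈-filter⁻; ∈-map⁺; ∈-map⁻)
open import Data.List.Relation.Unary.All as All using (All; []; _∷_)
open import Data.List.Relation.Unary.Any using (Any; here; there)
open import Data.Maybe using (just; nothing)
open import Data.Product using (∃; _×_; _,_; proj₁; proj₂; map₁; map₂)
open import Data.Product.Function.NonDependent.Propositional using (_×-⇔_)
open import Data.Sum using (_⊎_; inj₁; inj₂)
open import Data.Sum.Function.Propositional using (_⊎-⇔_)
open import Data.Vec as Vec using (Vec; []; _∷_)
open import Function using (_∘_)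
open import Function.Bundles using (_⇔_; mk⇔; Equivalence)
open import Function.Construct.Composition using (_⇔-∘_)
open import Function.Construct.Identity using (⇔-id)
open import Function.Construct.Symmetry using (⇔-sym)
open import Function.Related.Propositional using (≡⇒)
open import Function.Related.TypeIsomorphisms using (¬-cong-⇔)
open import Relation.Binary.PropositionalEquality
  using (_≡_; refl; sym; trans; cong; cong₂; subst; subst₂)
open import Relation.Binary.Construct.Closure.ReflexiveTransitive as Star using (Star; _◅_)
open import Relation.Nullary using (¬_; yes; no; contradiction)
open import Defs

open Equivalence using (to; from)

-- Arithmetic and order of Cauchy reals up to `_≈ℝ_`

Eventually : (ℕ → Set) → Set
Eventually P = ∃ λ N → ∀ n → N ℕ.≤ n → P n

eventually-map : ∀ {P Q : ℕ → Set} → (∀ n → P n → Q n) → Eventually P → Eventually Q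
eventually-map f = map₂ λ h n N≤n → f n (h n N≤n)

eventually-zip : ∀ {P Q R : ℕ → Set} → (∀ n → P n → Q n → R n) →
                 Eventually P → Eventually Q → Eventually R
eventually-zip f (M , g) (N , h) = M ℕ.⊔ N , λ n M⊔N≤n →
  f n (g n (ℕ.m⊔n≤o⇒m≤o M N M⊔N≤n)) (h n (ℕ.m⊔n≤o⇒n≤o M N M⊔N≤n))

∣p-q∣≡∣q-p∣ : ∀ p q → ℚ.∣ p ℚ.- q ∣ ≡ ℚ.∣ q ℚ.- p ∣
∣p-q∣≡∣q-p∣ p q = trans (sym (ℚ.∣-p∣≡∣p∣ (p ℚ.- q))) (cong ℚ.∣_∣ (⁻¹-anti-homo‿- p q))
  where open import Algebra.Properties.AbelianGroup ℚ.+-0-abelianGroup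

p≤∣p∣ : ∀ p → p ℚ.≤ ℚ.∣ p ∣
p≤∣p∣ p with ℚ.≤-total 0ℚ p
... | inj₁ 0≤p = ℚ.≤-reflexive (sym (ℚ.0≤p⇒∣p∣≡p 0≤p))
... | inj₂ p≤0 = ℚ.≤-trans p≤0 (ℚ.0≤∣p∣ p)

∣p-q∣<δ⇒p<q+δ : ∀ p q {δ} → ℚ.∣ p ℚ.- q ∣ ℚ.< δ → p ℚ.< q ℚ.+ δ
∣p-q∣<δ⇒p<q+δ p q h = subst (ℚ._< _) (sym (Cauchy.split p q))
  (ℚ.+-monoʳ-< q (ℚ.≤-<-trans (p≤∣p∣ (p ℚ.- q)) h))

+-cancelʳ-< : ∀ r {p q} → p ℚ.+ r ℚ.< q ℚ.+ r → p ℚ.< q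
+-cancelʳ-< r {p} {q} h = subst₂ ℚ._<_ (cancel p) (cancel q) (ℚ.+-monoˡ-< (ℚ.- r) h)
  where
  cancel : ∀ x → (x ℚ.+ r) ℚ.- r ≡ x
  cancel = //-rightDividesʳ (AbelianGroup.group ℚ.+-0-abelianGroup) r

+-half : ∀ p ε → p ℚ.+ ½ ℚ.* ε ℚ.+ ½ ℚ.* ε ≡ p ℚ.+ ε
+-half p ε = trans (ℚ.+-assoc p (½ ℚ.* ε) (½ ℚ.* ε)) (cong (p ℚ.+_) (Cauchy.½+½ ε))

≈ℝ-refl : ∀ {x} → x ≈ℝ x
≈ℝ-refl {x} ε 0<ε = 0 , λ n _ →
  subst (ℚ._< ε) (sym (cong ℚ.∣_∣ (ℚ.+-inverseʳ (seq x n)))) 0<ε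

≈ℝ-sym : ∀ {x y} → x ≈ℝ y → y ≈ℝ x
≈ℝ-sym {x} {y} x≈y ε 0<ε = eventually-map
  (λ n → subst (ℚ._< ε) (∣p-q∣≡∣q-p∣ (seq x n) (seq y n))) (x≈y ε 0<ε)

≈ℝ-trans : ∀ {x y z} → x ≈ℝ y → y ≈ℝ z → x ≈ℝ z
≈ℝ-trans {x} {y} {z} x≈y y≈z ε 0<ε = eventually-zip
  (λ n p q → begin-strict
    ℚ.∣ seq x n ℚ.- seq z n ∣
      ≡⟨ cong ℚ.∣_∣ (Cauchy.telescope (seq x n) (seq z n) (seq y n)) ⟩
    ℚ.∣ (seq x n ℚ.- seq y n) ℚ.+ (seq y n ℚ.- seq z n) ∣
      ≤⟨ ℚ.∣p+q∣≤∣p∣+∣q∣ (seq x n ℚ.- seq y n) (seq y n ℚ.- seq z n) ⟩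
    ℚ.∣ seq x n ℚ.- seq y n ∣ ℚ.+ ℚ.∣ seq y n ℚ.- seq z n ∣
      <⟨ ℚ.+-mono-< p q ⟩
    ½ ℚ.* ε ℚ.+ ½ ℚ.* ε
      ≡⟨ Cauchy.½+½ ε ⟩
    ε ∎)
  (x≈y (½ ℚ.* ε) (Cauchy.0<½* 0<ε)) (y≈z (½ ℚ.* ε) (Cauchy.0<½* 0<ε))
  where open ℚ.≤-Reasoning

+ℝ-cong : ∀ {x x′ y y′} → x ≈ℝ x′ → y ≈ℝ y′ → x +ℝ y ≈ℝ x′ +ℝ y′
+ℝ-cong {x} {x′} {y} {y′} x≈x′ y≈y′ ε 0<ε = eventually-zip
  (λ n p q → begin-strict
    ℚ.∣ (seq x n ℚ.+ seq y n) ℚ.- (seq x′ n ℚ.+ seq y′ n) ∣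
      ≡⟨ cong ℚ.∣_∣ (Cauchy.+-rearrange (seq x n) (seq y n) (seq x′ n) (seq y′ n)) ⟩
    ℚ.∣ (seq x n ℚ.- seq x′ n) ℚ.+ (seq y n ℚ.- seq y′ n) ∣
      ≤⟨ ℚ.∣p+q∣≤∣p∣+∣q∣ (seq x n ℚ.- seq x′ n) (seq y n ℚ.- seq y′ n) ⟩
    ℚ.∣ seq x n ℚ.- seq x′ n ∣ ℚ.+ ℚ.∣ seq y n ℚ.- seq y′ n ∣
      <⟨ ℚ.+-mono-< p q ⟩
    ½ ℚ.* ε ℚ.+ ½ ℚ.* ε
      ≡⟨ Cauchy.½+½ ε ⟩
    ε ∎)
  (x≈x′ (½ ℚ.* ε) (Cauchy.0<½* 0<ε)) (y≈y′ (½ ℚ.* ε) (Cauchy.0<½* 0<ε))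
  where open ℚ.≤-Reasoning

-- The sequence of `k` is eventually bounded by some `M` > 0, so asking `x ≈ℝ y` for accuracy `ε`
-- divided by `M` keeps the error of the products below `ε`.
*ℝ-congˡ : ∀ k {x y} → x ≈ℝ y → k *ℝ x ≈ℝ k *ℝ y
*ℝ-congˡ k {x} {y} x≈y ε 0<ε with Cauchy.bounded (seq k) (cauchy k)
... | M , 0<M , k-bounded = eventually-zip
  (λ n p q → begin-strict
    ℚ.∣ seq k n ℚ.* seq x n ℚ.- seq k n ℚ.* seq y n ∣
      ≡⟨ cong ℚ.∣_∣ (Cauchy.*-distribˡ-- (seq k n) (seq x n) (seq y n)) ⟩
    ℚ.∣ seq k n ℚ.* (seq x n ℚ.- seq y n) ∣
      ≡⟨ ℚ.∣p*q∣≡∣p∣*∣q∣ (seq k n) (seq x n ℚ.- seq y n) ⟩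
    ℚ.∣ seq k n ∣ ℚ.* ℚ.∣ seq x n ℚ.- seq y n ∣
      ≤⟨ ℚ.*-monoʳ-≤-nonNeg ℚ.∣ seq x n ℚ.- seq y n ∣
           {{ℚ.nonNegative (ℚ.0≤∣p∣ (seq x n ℚ.- seq y n))}} p ⟩
    M ℚ.* ℚ.∣ seq x n ℚ.- seq y n ∣
      <⟨ ℚ.*-monoʳ-<-pos M q ⟩
    M ℚ.* (ℚ.1/ M ℚ.* ε)
      ≡⟨ sym (ℚ.*-assoc M (ℚ.1/ M) ε) ⟩
    M ℚ.* ℚ.1/ M ℚ.* ε
      ≡⟨ cong (ℚ._* ε) (ℚ.*-inverseʳ M) ⟩
    ℚ.1ℚ ℚ.* ε
      ≡⟨ ℚ.*-identityˡ ε ⟩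
    ε ∎)
  k-bounded (x≈y (ℚ.1/ M ℚ.* ε) 0<ε/M)
  where
  open ℚ.≤-Reasoning
  instance
    M-pos : ℚ.Positive M
    M-pos = ℚ.positive 0<M
    M-nonZero : ℚ.NonZero M
    M-nonZero = ℚ.pos⇒nonZero M
  0<ε/M : 0ℚ ℚ.< ℚ.1/ M ℚ.* ε
  0<ε/M = subst (ℚ._< ℚ.1/ M ℚ.* ε) (ℚ.*-zeroʳ (ℚ.1/ M))
            (ℚ.*-monoʳ-<-pos (ℚ.1/ M) {{ℚ.1/pos⇒pos M}} 0<ε)

≈ℝ⇒≤ℝ : ∀ {x y} → x ≈ℝ y → x ≤ℝ y
≈ℝ⇒≤ℝ {x} {y} x≈y ε 0<ε =
  eventually-map (λ n → ∣p-q∣<δ⇒p<q+δ (seq x n) (seq y n)) (x≈y ε 0<ε)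

≤ℝ-trans : ∀ {x y z} → x ≤ℝ y → y ≤ℝ z → x ≤ℝ z
≤ℝ-trans {x} {y} {z} x≤y y≤z ε 0<ε = eventually-zip
  (λ n p q → subst (seq x n ℚ.<_) (+-half (seq z n) ε) (ℚ.<-trans p (ℚ.+-monoˡ-< (½ ℚ.* ε) q)))
  (x≤y (½ ℚ.* ε) (Cauchy.0<½* 0<ε)) (y≤z (½ ℚ.* ε) (Cauchy.0<½* 0<ε))

-- Half of the gap `ε` pays for the tolerance of `y ≤ℝ z`; the other half remains as the gap between
-- `x` and `z`.
<ℝ-≤ℝ-trans : ∀ {x y z} → x <ℝ y → y ≤ℝ z → x <ℝ z
<ℝ-≤ℝ-trans {x} {y} {z} (ε , 0<ε , x<y) y≤z = ½ ℚ.* ε , Cauchy.0<½* 0<ε , eventually-zip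
  (λ n p q → +-cancelʳ-< (½ ℚ.* ε)
    (subst (ℚ._< seq z n ℚ.+ ½ ℚ.* ε) (sym (+-half (seq x n) ε)) (ℚ.<-trans p q)))
  x<y (y≤z (½ ℚ.* ε) (Cauchy.0<½* 0<ε))

≤ℝ-<ℝ-trans : ∀ {x y z} → x ≤ℝ y → y <ℝ z → x <ℝ z
≤ℝ-<ℝ-trans {x} {y} {z} x≤y (ε , 0<ε , y<z) = ½ ℚ.* ε , Cauchy.0<½* 0<ε , eventually-zip
  (λ n p q → ℚ.<-trans
    (subst (seq x n ℚ.+ ½ ℚ.* ε ℚ.<_) (+-half (seq y n) ε) (ℚ.+-monoˡ-< (½ ℚ.* ε) p)) q)
  (x≤y (½ ℚ.* ε) (Cauchy.0<½* 0<ε)) y<z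

-- Equality of values, uniformly in the sort

infix 4 _≋_

-- Eq computes on the sort, so its arguments cannot be inferred from its value.  The record is injective.
record _≋_ {s} (x y : ⟦ s ⟧) : Set where
  constructor ≋⟨_⟩
  field
    toEq : Eq x y

open _≋_

≋-refl : ∀ {s} {x : ⟦ s ⟧} → x ≋ x
≋-refl {int}      = ≋⟨ refl ⟩
≋-refl {rat}      = ≋⟨ refl ⟩
≋-refl {real} {x} = ≋⟨ ≈ℝ-refl {x} ⟩

≋-reflexive : ∀ {s} {x y : ⟦ s ⟧} → x ≡ y → x ≋ y
≋-reflexive refl = ≋-refl

≋-sym : ∀ {s} {x y : ⟦ s ⟧} → x ≋ y → y ≋ x
≋-sym {int}          ≋⟨ p ⟩ = ≋⟨ sym p ⟩
≋-sym {rat}          ≋⟨ p ⟩ = ≋⟨ sym p ⟩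
≋-sym {real} {x} {y} ≋⟨ p ⟩ = ≋⟨ ≈ℝ-sym {x} {y} p ⟩

≋-trans : ∀ {s} {x y z : ⟦ s ⟧} → x ≋ y → y ≋ z → x ≋ z
≋-trans {int}              ≋⟨ p ⟩ ≋⟨ q ⟩ = ≋⟨ trans p q ⟩
≋-trans {rat}              ≋⟨ p ⟩ ≋⟨ q ⟩ = ≋⟨ trans p q ⟩
≋-trans {real} {x} {y} {z} ≋⟨ p ⟩ ≋⟨ q ⟩ = ≋⟨ ≈ℝ-trans {x} {y} {z} p q ⟩

add-cong : ∀ {s} {x x′ y y′ : ⟦ s ⟧} → x ≋ x′ → y ≋ y′ → add x y ≋ add x′ y′
add-cong {int}                      ≋⟨ p ⟩ ≋⟨ q ⟩ = ≋⟨ cong₂ ℤ._+_ p q ⟩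
add-cong {rat}                      ≋⟨ p ⟩ ≋⟨ q ⟩ = ≋⟨ cong₂ ℚ._+_ p q ⟩
add-cong {real} {x} {x′} {y} {y′} ≋⟨ p ⟩ ≋⟨ q ⟩ = ≋⟨ +ℝ-cong {x} {x′} {y} {y′} p q ⟩

mul-congˡ : ∀ {s} (k : ⟦ s ⟧) {x y : ⟦ s ⟧} → x ≋ y → mul k x ≋ mul k y
mul-congˡ {int}  k         ≋⟨ p ⟩ = ≋⟨ cong (k ℤ.*_) p ⟩
mul-congˡ {rat}  k         ≋⟨ p ⟩ = ≋⟨ cong (k ℚ.*_) p ⟩
mul-congˡ {real} k {x} {y} ≋⟨ p ⟩ = ≋⟨ *ℝ-congˡ k {x} {y} p ⟩

Respects≋ : ∀ {s} → (⟦ s ⟧ → ⟦ s ⟧ → Set) → Set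
Respects≋ R = ∀ {x x′ y y′} → x ≋ x′ → y ≋ y′ → R x y → R x′ y′

Eq-resp : ∀ s → Respects≋ (Eq {s})
Eq-resp s x≋x′ y≋y′ x≈y = toEq (≋-trans (≋-sym x≋x′) (≋-trans ≋⟨ x≈y ⟩ y≋y′))

Lt-resp : ∀ s → Respects≋ (Lt {s})
Lt-resp int ≋⟨ p ⟩ ≋⟨ q ⟩ = subst₂ ℤ._<_ p q
Lt-resp rat ≋⟨ p ⟩ ≋⟨ q ⟩ = subst₂ ℚ._<_ p q
Lt-resp real {x} {x′} {y} {y′} ≋⟨ p ⟩ ≋⟨ q ⟩ x<y =
  ≤ℝ-<ℝ-trans {x′} {x} {y′} (≈ℝ⇒≤ℝ {x′} {x} (≈ℝ-sym {x} {x′} p))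
    (<ℝ-≤ℝ-trans {x} {y} {y′} x<y (≈ℝ⇒≤ℝ {y} {y′} q))

Le-resp : ∀ s → Respects≋ (Le {s})
Le-resp int ≋⟨ p ⟩ ≋⟨ q ⟩ = subst₂ ℤ._≤_ p q
Le-resp rat ≋⟨ p ⟩ ≋⟨ q ⟩ = subst₂ ℚ._≤_ p q
Le-resp real {x} {x′} {y} {y′} ≋⟨ p ⟩ ≋⟨ q ⟩ x≤y =
  ≤ℝ-trans {x′} {x} {y′} (≈ℝ⇒≤ℝ {x′} {x} (≈ℝ-sym {x} {x′} p))
    (≤ℝ-trans {x} {y} {y′} x≤y (≈ℝ⇒≤ℝ {y} {y′} q))

resp⇒⇔ : ∀ {s} {R : ⟦ s ⟧ → ⟦ s ⟧ → Set} → Respects≋ R →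
         ∀ {x x′ y y′} → x ≋ x′ → y ≋ y′ → R x y ⇔ R x′ y′
resp⇒⇔ resp x≋x′ y≋y′ = mk⇔ (resp x≋x′ y≋y′) (resp (≋-sym x≋x′) (≋-sym y≋y′))

-- Invariance of satisfaction under pointwise equal assignments

infix 4 _≈_

_≈_ : ∀ {X} {σ : X → Sort} → Assignment σ → Assignment σ → Set
α ≈ β = ∀ x → α x ≋ β x

module _ {X : Set} {σ : X → Sort} where

  ⟦⟧ᵗ-cong : ∀ {s} (t : Term σ s) {α β : Assignment σ} → α ≈ β → ⟦ t ⟧ᵗ α ≋ ⟦ t ⟧ᵗ β
  ⟦⟧ᵗ-cong (var x)   α≈β = α≈β x
  ⟦⟧ᵗ-cong (const _) α≈β = ≋-refl
  ⟦⟧ᵗ-cong (t ⊕ u)   α≈β = add-cong (⟦⟧ᵗ-cong t α≈β) (⟦⟧ᵗ-cong u α≈β)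
  ⟦⟧ᵗ-cong (k ⊙ t)   α≈β = mul-congˡ k (⟦⟧ᵗ-cong t α≈β)

  ⊨ᶜ-cong : ∀ c {α β : Assignment σ} → α ≈ β → (α ⊨ᶜ c) ⇔ (β ⊨ᶜ c)
  ⊨ᶜ-cong true             α≈β = ⇔-id _
  ⊨ᶜ-cong (eq {s} t u)     α≈β = resp⇒⇔ (Eq-resp s) (⟦⟧ᵗ-cong t α≈β) (⟦⟧ᵗ-cong u α≈β)
  ⊨ᶜ-cong (lt {s} t u)     α≈β = resp⇒⇔ (Lt-resp s) (⟦⟧ᵗ-cong t α≈β) (⟦⟧ᵗ-cong u α≈β)
  ⊨ᶜ-cong (le {s} t u)     α≈β = resp⇒⇔ (Le-resp s) (⟦⟧ᵗ-cong t α≈β) (⟦⟧ᵗ-cong u α≈β)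
  -- Congruences relate integer terms, and at sort `int` the relation `_≋_` unpacks to `_≡_`, so
  -- plain rewriting suffices.
  ⊨ᶜ-cong (congruent m t u) α≈β = ≡⇒ (cong₂ (λ x y → ℤ.+ m ℤ.∣ x ℤ.- y)
    (toEq (⟦⟧ᵗ-cong t α≈β)) (toEq (⟦⟧ᵗ-cong u α≈β)))
  ⊨ᶜ-cong (and c d) α≈β = ⊨ᶜ-cong c α≈β ×-⇔ ⊨ᶜ-cong d α≈β
  ⊨ᶜ-cong (or c d)  α≈β = ⊨ᶜ-cong c α≈β ⊎-⇔ ⊨ᶜ-cong d α≈β
  ⊨ᶜ-cong (not c)   α≈β = ¬-cong-⇔ (⊨ᶜ-cong c α≈β)

  ▹-congˡ : ∀ {Y} {τ : Y → Sort} {α α′ : Assignment σ} {β : Assignment τ} →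
            α ≈ α′ → (α ▹ β) ≈ (α′ ▹ β)
  ▹-congˡ α≈α′ (inj₁ x) = α≈α′ x
  ▹-congˡ α≈α′ (inj₂ y) = ≋-refl

-- Substitution lemmas

module _ {X Y : Set} {σ : X → Sort} {τ : Y → Sort} where

  ⟦substᵗ⟧ : ∀ (f : Substitution σ τ) {s} (t : Term σ s) {α} →
             ⟦ substᵗ f t ⟧ᵗ α ≡ ⟦ t ⟧ᵗ (λ x → ⟦ f x ⟧ᵗ α)
  ⟦substᵗ⟧ f (var x)   = refl
  ⟦substᵗ⟧ f (const k) = refl
  ⟦substᵗ⟧ f (t ⊕ u)   = cong₂ add (⟦substᵗ⟧ f t) (⟦substᵗ⟧ f u)
  ⟦substᵗ⟧ f (k ⊙ t)   = cong (mul k) (⟦substᵗ⟧ f t)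

  -- Evaluation commutes with substitution propositionally at every sort, so the satisfaction types
  -- themselves are equal. `_≋_` enters only when the assignment is exchanged, in `⊨-substᶜ`.
  ⊨-substᶜ-≡ : ∀ (f : Substitution σ τ) c {α} →
               (α ⊨ᶜ substᶜ f c) ≡ ((λ x → ⟦ f x ⟧ᵗ α) ⊨ᶜ c)
  ⊨-substᶜ-≡ f true     = refl
  ⊨-substᶜ-≡ f (eq t u) = cong₂ Eq (⟦substᵗ⟧ f t) (⟦substᵗ⟧ f u)
  ⊨-substᶜ-≡ f (lt t u) = cong₂ Lt (⟦substᵗ⟧ f t) (⟦substᵗ⟧ f u)
  ⊨-substᶜ-≡ f (le t u) = cong₂ Le (⟦substᵗ⟧ f t) (⟦substᵗ⟧ f u)
  ⊨-substᶜ-≡ f (congruent m t u) =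
    cong₂ (λ x y → ℤ.+ m ℤ.∣ x ℤ.- y) (⟦substᵗ⟧ f t) (⟦substᵗ⟧ f u)
  ⊨-substᶜ-≡ f (and c d) = cong₂ _×_ (⊨-substᶜ-≡ f c) (⊨-substᶜ-≡ f d)
  ⊨-substᶜ-≡ f (or c d)  = cong₂ _⊎_ (⊨-substᶜ-≡ f c) (⊨-substᶜ-≡ f d)
  ⊨-substᶜ-≡ f (not c)   = cong ¬_ (⊨-substᶜ-≡ f c)

  ⊨-substᶜ : ∀ {f : Substitution σ τ} c {α β} → (∀ x → ⟦ f x ⟧ᵗ α ≋ β x) →
             (α ⊨ᶜ substᶜ f c) ⇔ (β ⊨ᶜ c)
  ⊨-substᶜ {f} c f≈β = ⊨ᶜ-cong c f≈β ⇔-∘ ≡⇒ (⊨-substᶜ-≡ f c)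

-- Letting `β` be any assignment that agrees pointwise with the substituted one avoids function
-- extensionality. It also carries the quantifier case: under `exists` both sides are extended by
-- the same witness, and the extensions still agree pointwise.
⊨-substᶠ : ∀ {X Y} {σ : X → Sort} {τ : Y → Sort} {f : Substitution σ τ} φ {α β} →
           (∀ x → ⟦ f x ⟧ᵗ α ≋ β x) → (α ⊨ᶠ substᶠ f φ) ⇔ (β ⊨ᶠ φ)
⊨-substᶠ ⌜ c ⌝     f≈β = ⊨-substᶜ c f≈β
⊨-substᶠ (and φ θ) f≈β = ⊨-substᶠ φ f≈β ×-⇔ ⊨-substᶠ θ f≈β
⊨-substᶠ (or φ θ)  f≈β = ⊨-substᶠ φ f≈β ⊎-⇔ ⊨-substᶠ θ f≈β
⊨-substᶠ (not φ)   f≈β = ¬-cong-⇔ (⊨-substᶠ φ f≈β)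
⊨-substᶠ {f = f} (exists υ φ) {α} {β} f≈β =
  mk⇔ (map₂ (to (⊨-substᶠ φ lift≈▹))) (map₂ (from (⊨-substᶠ φ lift≈▹)))
  where
  lift≈▹ : ∀ {δ : Assignment υ} x → ⟦ lift υ f x ⟧ᵗ (α ▹ δ) ≋ (β ▹ δ) x
  lift≈▹ (inj₁ x) = ≋-trans (≋-reflexive (⟦substᵗ⟧ _ (f x))) (f≈β x)
  lift≈▹ (inj₂ z) = ≋-refl

-- Finite conjunctions and disjunctions

module _ {X : Set} {σ : X → Sort} {A : Set} where

  ⊨-⋀-map : ∀ (f : A → Constraint σ) xs {α} →
            (α ⊨ᶜ ⋀ (map f xs)) ⇔ (∀ {x} → x ∈ xs → α ⊨ᶜ f x)
  ⊨-⋀-map f xs = mk⇔ (All.lookup ∘ toAll xs) (fromAll xs ∘ All.tabulate)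
    where
    toAll : ∀ xs {α} → α ⊨ᶜ ⋀ (map f xs) → All (λ x → α ⊨ᶜ f x) xs
    toAll []       _       = []
    toAll (x ∷ xs) (p , q) = p ∷ toAll xs q
    fromAll : ∀ xs {α} → All (λ x → α ⊨ᶜ f x) xs → α ⊨ᶜ ⋀ (map f xs)
    fromAll []       []       = _
    fromAll (x ∷ xs) (p ∷ ps) = p , fromAll xs ps

  ⊨-⋁-map : ∀ (f : A → Formula σ) xs {α} →
            (α ⊨ᶠ ⋁ (map f xs)) ⇔ Any (λ x → α ⊨ᶠ f x) xs
  ⊨-⋁-map f xs = mk⇔ (toAny xs) fromAny
    where
    toAny : ∀ xs {α} → α ⊨ᶠ ⋁ (map f xs) → Any (λ x → α ⊨ᶠ f x) xs
    -- The empty disjunction is `not true`, so `p` refutes the unit type.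
    toAny []       p        = contradiction _ p
    toAny (x ∷ xs) (inj₁ p) = here p
    toAny (x ∷ xs) (inj₂ q) = there (toAny xs q)
    fromAny : ∀ {xs α} → Any (λ x → α ⊨ᶠ f x) xs → α ⊨ᶠ ⋁ (map f xs)
    fromAny (here p)  = inj₁ p
    fromAny (there p) = inj₂ (fromAny p)

-- Semantics of the formulas attached to product states

module _ {n : ℕ} {σ : Fin n → Sort} (𝓑 : DDSA σ) where
  open DDSA 𝓑

  ⊨-φν : ∀ {α₀ α : Assignment σ} → (α₀ ▹ α ⊨ᶠ φν 𝓑) ⇔ α ≈ α₀
  ⊨-φν = mk⇔ (λ h v → ≋⟨ h (∈-allFin v) ⟩) (λ h {v} _ → toEq (h v)) ⇔-∘ ⊨-⋀-map _ (allFin n)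

  -- Puts `Δ` into the form of the guard and frame premises of `step`, so that models of `Δ` and
  -- steps of the DDSA can be exchanged.
  ⊨-Δ : ∀ a {α β : Assignment σ} → (α ▹ β ⊨ᶜ Δ 𝓑 a) ⇔
        ((α ▹ β ⊨ᶜ guard a) × (∀ v → ¬ Written 𝓑 a v → β v ≋ α v))
  ⊨-Δ a = ⇔-id _ ×-⇔
    (mk⇔ (λ h v v∉ → ≋⟨ h (∈-filter⁺ _ (∈-allFin v) v∉) ⟩)
         (λ h {v} v∈ → toEq (h v (proj₂ (∈-filter⁻ _ {xs = allFin n} v∈))))
     ⇔-∘ ⊨-⋀-map _ _)

  -- The bound block holds the values before the action, so a witness for it is the assignment of
  -- the preceding configuration.
  ⊨-update : ∀ φ a {α₀ β : Assignment σ} → (α₀ ▹ β ⊨ᶠ update 𝓑 φ a) ⇔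
             (∃ λ α → (α₀ ▹ α ⊨ᶠ φ) × (α ▹ β ⊨ᶜ Δ 𝓑 a))
  ⊨-update φ a {α₀} {β} = mk⇔ (map₂ (to (equiv _))) (map₂ (from (equiv _)))
    where
    equiv : ∀ α → _ ⇔ ((α₀ ▹ α ⊨ᶠ φ) × (α ▹ β ⊨ᶜ Δ 𝓑 a))
    equiv α = ⊨-substᶠ φ (λ { (inj₁ v) → ≋-refl ; (inj₂ v) → ≋-refl })
          ×-⇔ ⊨-substᶜ (Δ 𝓑 a) (λ { (inj₁ v) → ≋-refl ; (inj₂ v) → ≋-refl })

  ⊨-project : ∀ φ {α : Assignment σ} → (α ⊨ᶠ project 𝓑 φ) ⇔ (∃ λ β → α ▹ β ⊨ᶠ φ)
  ⊨-project φ {α} = mk⇔ (map₂ (to (equiv _))) (map₂ (from (equiv _)))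
    where
    equiv : ∀ β → _ ⇔ (α ▹ β ⊨ᶠ φ)
    equiv β = ⊨-substᶠ φ (λ { (inj₁ v) → ≋-refl ; (inj₂ v) → ≋-refl })

-- Runs of the DDSA and paths of the product automaton

module _ {n : ℕ} {σ : Fin n → Sort} (𝓑 : DDSA σ) (N : NFA 𝓑) where
  open DDSA 𝓑
  open NFA N

  -- The left side of `Recognises`, generalised from `q₀` to any NFA state so that it passes to the
  -- tail of a run.
  Matches : ∀ {γ} → Fin states → Run 𝓑 γ → Set
  Matches q ρ = ∃ λ (w : Vec Letter (suc (length 𝓑 ρ))) →
    AcceptsFrom q (Vec.toList w) × (∀ i → _⊨ᵏ_ 𝓑 (at 𝓑 ρ i) (⋀𝒦 (Vec.lookup w i)))

  AcceptingRun : Fin states → Configuration 𝓑 → Set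
  AcceptingRun q γ = ∃ λ ((ρ , _) : FRuns 𝓑 γ) → Matches q ρ

  -- Only the first configuration changes. Its letter and the guard and frame condition of the first
  -- step are invariant under `_≋_`; the target of that step, and hence the rest of the run, stays
  -- the same.
  AcceptingRun-cong : ∀ {q b α β} → α ≈ β → AcceptingRun q (b , α) → AcceptingRun q (b , β)
  AcceptingRun-cong {b = b} {β = β} α≈β ((stop _ , fin) , w , acc , sat) =
    (stop (b , β) , fin) , w , acc ,
    λ { zero → to (⊨ᶜ-cong (⋀𝒦 (Vec.lookup w zero) b) α≈β) (sat zero) }
  AcceptingRun-cong {b = b} α≈β ((next (step {a = a} tr keep g) ρ , fin) , w , acc , sat) =
    (next (step tr
      (λ v v∉ → toEq (≋-trans ≋⟨ keep v v∉ ⟩ (α≈β v)))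
      (to (⊨ᶜ-cong (guard a) (▹-congˡ α≈β)) g)) ρ , fin) , w , acc ,
    λ { zero → to (⊨ᶜ-cong (⋀𝒦 (Vec.lookup w zero) b) α≈β) (sat zero)
      ; (suc i) → sat (suc i) }

  module _ (b : State) where
    open Product 𝓑 N b

    formula : PState → Formula (σ ⊞ σ)
    formula (_ , _ , φ) = φ

    Final : PState → Set
    Final (b′ , q , _) = b′ ∈ₛ DDSA.final 𝓑ᵇ × q ∈ₛ accepting

    ⊨-successor : ∀ φ a w b″ {α₀ β : Assignment σ} → (α₀ ▹ β ⊨ᶠ successor φ a w b″) ⇔
      ((α₀ ▹ β ⊨ᶠ update 𝓑ᵇ φ a) × (β ⊨ᶜ ⋀𝒦 w b″))
    ⊨-successor φ a w b″ = ⇔-id _ ×-⇔ ⊨-substᶜ (⋀𝒦 w b″) (λ _ → ≋-refl)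

    module _ {α₀ : Assignment σ} where

      -- By induction on `ρ`, with the product one transition behind: the letter of a configuration
      -- is read on the move entering its control state. The premises on `a` and `update` describe
      -- this pending move, so a run of k steps gives k + 1 moves, one per letter.
      run⇒path : ∀ {b₀ q φ a b′ α} (ρ : Run 𝓑 (b′ , α)) →
        proj₁ (last 𝓑 ρ) ∈ₛ final → Matches q ρ →
        DDSA.Trans 𝓑ᵇ b₀ a (suc b′) → α₀ ▹ α ⊨ᶠ update 𝓑ᵇ φ a →
        ∃ λ s → Star _⟶_ (b₀ , q , φ) s × Final s × ∃ λ β → α₀ ▹ β ⊨ᶠ formula s
      run⇒path {φ = φ} {a} {b′} {α} ρ fin (w ∷ ws , (q′ , q′∈ , acc) , sat) tr upd =
        path ρ fin ws acc sat
        where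
        φ′ = successor φ a w b′
        α₀▹α⊨φ′ : α₀ ▹ α ⊨ᶠ φ′
        α₀▹α⊨φ′ = from (⊨-successor φ a w b′) (upd , sat zero)
        m : _ ⟶ (suc b′ , q′ , φ′)
        -- The current assignments witness satisfiability, and `successor` itself is taken as the
        -- representative of its equivalence class.
        m = move tr q′∈ (_ , α₀▹α⊨φ′) (λ _ → ⇔-id _)
        -- Splitting on the run only now lets both cases share the move `m`.
        path : ∀ (ρ : Run 𝓑 (b′ , α)) → proj₁ (last 𝓑 ρ) ∈ₛ final →
          (ws : Vec Letter (length 𝓑 ρ)) → AcceptsFrom q′ (Vec.toList ws) →
          (∀ i → _⊨ᵏ_ 𝓑 (at 𝓑 ρ i) (⋀𝒦 (Vec.lookup (w ∷ ws) i))) → _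
        path (stop _) fin [] acc sat = _ , m ◅ Star.ε , (Vec.there fin , acc) , α , α₀▹α⊨φ′
        path (next (step {a = a′} tr′ keep g) ρ) fin ws acc sat =
          map₂ (map₁ (m ◅_)) (run⇒path ρ fin (ws , acc , sat ∘ suc) (old tr′)
            (from (⊨-update 𝓑ᵇ φ′ (just a′))
              (α , α₀▹α⊨φ′ , from (⊨-Δ 𝓑ᵇ (just a′)) (g , λ v v∉ → ≋⟨ keep v v∉ ⟩))))

      -- The run is rebuilt from its end: the model of the last formula fixes the last assignment,
      -- and each `update` yields the one before. The first move is kept apart, with its `update`
      -- still folded, so that the conclusion is what the caller needs to prepend one more step.
      path⇒run : ∀ {b₀ q φ s t} → (b₀ , q , φ) ⟶ s → Star _⟶_ s t → Final t →
        (∃ λ β → α₀ ▹ β ⊨ᶠ formula t) →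
        ∃ λ a → ∃ λ b′ → ∃ λ α → DDSA.Trans 𝓑ᵇ b₀ a (suc b′) ×
          (α₀ ▹ α ⊨ᶠ update 𝓑ᵇ φ a) × AcceptingRun q (b′ , α)
      path⇒run {φ = φ} (move {a = a} {w} {b″} {q′} tr q′∈ _ φ′≃) Star.ε (fin , acc) (β , h) =
        let upd , sat = to (⊨-successor φ a w b″) (to (φ′≃ _) h) in
        a , b″ , β , tr , upd ,
        (stop _ , drop-there fin) , w ∷ [] , (q′ , q′∈ , acc) , λ { zero → sat }
      path⇒run {φ = φ} (move {a = a} {w} {b″} {q′} {φ′} tr q′∈ _ φ′≃) (m ◅ path) fin h
        with path⇒run m path fin h
      -- The path continues from a state `suc b″`, which the dummy transition cannot leave, so the
      -- action comes from the original DDSA.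
      ... | just a′ , b‴ , β , old tr′ , upd′ , (ρ , fin′) , ws , acc , sats =
        let α , α₀▹α⊨φ′ , δ = to (⊨-update 𝓑ᵇ φ′ (just a′)) upd′
            g , keep = to (⊨-Δ 𝓑ᵇ (just a′)) δ
            upd , sat = to (⊨-successor φ a w b″) (to (φ′≃ _) α₀▹α⊨φ′) in
        a , b″ , α , tr , upd ,
        (next (step tr′ (λ v v∉ → toEq (keep v v∉)) g) ρ , fin′) , w ∷ ws , (q′ , q′∈ , acc) ,
        λ { zero → sat ; (suc i) → sats i }

      path⇔run : (∃ λ s → Reachable s × Final s × ∃ λ β → α₀ ▹ β ⊨ᶠ formula s) ⇔
                 AcceptingRun q₀ (b , α₀)
      path⇔run = mk⇔ fwd bwd
        where
        fwd : _ → _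
        -- The empty path ends in the dummy state, which is not final.
        fwd (_ , Star.ε , (() , _) , _)
        fwd (s , m ◅ path , fin , h) with path⇒run m path fin h
        ... | nothing , _ , α , start , upd , r =
          let α′ , init-φν , δ = to (⊨-update 𝓑ᵇ (φν 𝓑ᵇ) nothing) upd
              _ , keep = to (⊨-Δ 𝓑ᵇ nothing) δ in
          -- The dummy action writes nothing, so `α` agrees with `α′`, and `φν` makes `α′` agree
          -- with `α₀`.
          AcceptingRun-cong (λ v → ≋-trans (keep v λ ()) (to (⊨-φν 𝓑ᵇ) init-φν v)) r
        bwd : _ → _
        bwd ((ρ , fin) , matches) = run⇒path ρ fin matches start
          (from (⊨-update 𝓑ᵇ (φν 𝓑ᵇ) nothing)
            (α₀ , from (⊨-φν 𝓑ᵇ) (λ _ → ≋-refl) , from (⊨-Δ 𝓑ᵇ nothing) (_ , λ _ _ → ≋-refl)))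

      -- Soundness of the finite list makes each disjunct come from a reachable final state;
      -- completeness finds every reachable final state in the list up to logical equivalence, which
      -- preserves its models. The assignment bound by `project` is the one at the end of the run.
      ⊨-Φ : (F : Finite) →
        (α₀ ⊨ᶠ ⋁ (map (project 𝓑) (Finite.Φ F))) ⇔ AcceptingRun q₀ (b , α₀)
      ⊨-Φ F = path⇔run ⇔-∘ (mk⇔ fwd bwd ⇔-∘ ⊨-⋁-map (project 𝓑) Φ)
        where
        open Finite F
        isFinal? = λ (s : PState) → proj₁ s ∈ₛ? DDSA.final 𝓑ᵇ
        accepts? = λ (s : PState) → proj₁ (proj₂ s) ∈ₛ? accepting
        fwd : _ → _
        fwd h with find h
        ... | φ , φ∈ , sat with ∈-map⁻ formula φ∈
        ... | s , s∈ , refl with ∈-filter⁻ accepts? s∈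
        ... | s∈′ , acc with ∈-filter⁻ isFinal? s∈′
        ... | s∈″ , fin = s , All.lookup sound s∈″ , (fin , acc) , to (⊨-project 𝓑 φ) sat
        bwd : _ → _
        bwd (s , reach , (fin , acc) , β , h) with find (complete reach)
        -- The listed state has the same control and NFA states, hence is final too; only its
        -- formula may differ.
        ... | s′ , s′∈ , refl , refl , φ≃ = lose
          (∈-map⁺ formula (∈-filter⁺ accepts? (∈-filter⁺ isFinal? s′∈ fin) acc))
          (from (⊨-project 𝓑 (formula s′)) (β , to (φ≃ _) h))

-- Correctness of `checkPath` and of the translation to LTL

module _ {n : ℕ} {σ : Fin n → Sort} (𝓑 : DDSA σ) where
  open DDSA 𝓑

  -- Chains three equivalences: the choice of a constraint for the quantified disjunction, the
  -- product automaton, and recognition of `ψ` by the NFA.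
  ⊨-result : ∀ {ψ} (p : CheckPath 𝓑 ψ) b α → (α ⊨ᶜ CheckPath.result p b) ⇔
             (∃ λ ((ρ , _) : FRuns 𝓑 (b , α)) → _⊨ˡ_ 𝓑 (ρ , zero) ψ)
  ⊨-result p b α = mk⇔ (map₂ (to (recognises _))) (map₂ (from (recognises _)))
                   ⇔-∘ (⊨-Φ 𝓑 nfa b (finite b) ⇔-∘ result-≃ b α)
    where open CheckPath p

  ⊨-Kctrl : ∀ b b′ {α} → (b ≡ b′) ⇔ (α ⊨ᶜ Kctrl 𝓑 b′ b)
  ⊨-Kctrl b b′ with b ≟ b′
  ... | yes b≡b′ = mk⇔ _ (λ _ → b≡b′)
  ... | no  b≢b′ = mk⇔ (λ b≡b′ _ → b≢b′ b≡b′) (λ h → contradiction _ h)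

  mutual
    -- `checkState` and `toLTLˢ` treat Boolean connectives differently, as operations on maps and as
    -- LTL connectives, but use the same map for `E`. This case thus serves both inductions.
    E-correct : ∀ ψ (d : Defined 𝓑 (E ψ)) γ →
      (_⊨ˢ_ 𝓑 γ (E ψ)) ⇔ (_⊨ᵏ_ 𝓑 γ (CheckPath.result (proj₂ d)))
    E-correct ψ (d , p) (b , α) = ⇔-sym (⊨-result p b α) ⇔-∘
      mk⇔ (map₂ (to (toLTL-correct ψ d _ zero))) (map₂ (from (toLTL-correct ψ d _ zero)))

    toLTLˢ-correct : ∀ χ (d : Defined 𝓑 χ) {γ} (ρ : Run 𝓑 γ) i →
      (_⊨ˢ_ 𝓑 (at 𝓑 ρ i) χ) ⇔ (_⊨ˡ_ 𝓑 (ρ , i) (toLTLˢ 𝓑 χ d))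
    toLTLˢ-correct ⊤ˢ         d        ρ i = ⇔-id _
    toLTLˢ-correct (constr c) d        ρ i = ⇔-id _
    toLTLˢ-correct (ctrl b)   d        ρ i = ⊨-Kctrl _ b
    toLTLˢ-correct (χ ∧ˢ χ′)  (d , d′) ρ i = toLTLˢ-correct χ d ρ i ×-⇔ toLTLˢ-correct χ′ d′ ρ i
    toLTLˢ-correct (¬ˢ χ)     d        ρ i = ¬-cong-⇔ (toLTLˢ-correct χ d ρ i)
    toLTLˢ-correct (E ψ)      d        ρ i = E-correct ψ d (at 𝓑 ρ i)

    -- Stated at every position because the temporal operators move along the run, and as an
    -- equivalence because negation exchanges the two directions.
    toLTL-correct : ∀ ψ (d : Definedᵖ 𝓑 ψ) {γ} (ρ : Run 𝓑 γ) i →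
      (_⊨ᵖ_ 𝓑 (ρ , i) ψ) ⇔ (_⊨ˡ_ 𝓑 (ρ , i) (toLTL 𝓑 ψ d))
    toLTL-correct (state χ) d        ρ i = toLTLˢ-correct χ d ρ i
    toLTL-correct (ψ ∧ᵖ ψ′) (d , d′) ρ i = toLTL-correct ψ d ρ i ×-⇔ toLTL-correct ψ′ d′ ρ i
    toLTL-correct (¬ᵖ ψ)    d        ρ i = ¬-cong-⇔ (toLTL-correct ψ d ρ i)
    toLTL-correct (X ψ)     d        ρ i = mk⇔
      (map₂ (map₂ (to (toLTL-correct ψ d ρ _))))
      (map₂ (map₂ (from (toLTL-correct ψ d ρ _))))
    toLTL-correct (G ψ)     d        ρ i = mk⇔
      (λ h j i≤j → to (toLTL-correct ψ d ρ j) (h j i≤j))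
      (λ h j i≤j → from (toLTL-correct ψ d ρ j) (h j i≤j))
    toLTL-correct (ψ U ψ′)  (d , d′) ρ i = mk⇔
      (map₂ λ (i≤k , h′ , h) → i≤k , to (toLTL-correct ψ′ d′ ρ _) h′ ,
        λ j i≤j j<k → to (toLTL-correct ψ d ρ j) (h j i≤j j<k))
      (map₂ λ (i≤k , h′ , h) → i≤k , from (toLTL-correct ψ′ d′ ρ _) h′ ,
        λ j i≤j j<k → from (toLTL-correct ψ d ρ j) (h j i≤j j<k))

theorem2 : ∀ {n : ℕ} {σ : Fin n → Sort} (𝓑 : DDSA σ) (χ : StateFormula 𝓑)
    (d : Defined 𝓑 χ) (b : DDSA.State 𝓑) (α : Assignment σ) →
    (_⊨ˢ_ 𝓑 (b , α) χ) ⇔ (α ⊨ᶜ checkState 𝓑 χ d b)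
theorem2 𝓑 ⊤ˢ         d        b α = ⇔-id _
theorem2 𝓑 (constr c) d        b α = ⇔-id _
theorem2 𝓑 (ctrl b′)  d        b α = ⊨-Kctrl 𝓑 b b′
theorem2 𝓑 (χ ∧ˢ χ′)  (d , d′) b α = theorem2 𝓑 χ d b α ×-⇔ theorem2 𝓑 χ′ d′ b α
theorem2 𝓑 (¬ˢ χ)     d        b α = ¬-cong-⇔ (theorem2 𝓑 χ d b α)
theorem2 𝓑 (E ψ)      d        b α = E-correct 𝓑 ψ d (b , α)
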